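{- $\mathrm{MPL}<\mathrm{MTL}<\mathrm{MSO}$, both over the class of all Kripke trees and over the class of finitely-branching Kripke trees.
   Context: Trees. A tree $T$ is a subset of $\mathbb{N}^*$ (finite words over the naturals) with an element $\tau_0\in T$ (the root) such that every $\tau\in T$ has the form $\tau_0\cdot\tau'$ with $\tau'\in\mathbb{N}^*$, and whenever $\tau_0\cdot\tau\in T$ and $\tau'$ is a prefix of $\tau$, also $\tau_0\cdot\tau'\in T$. Elements of $T$ are nodes. A child of $\tau$ in $T$ is a node of $T$ of the form $\tau\cdot n$, $n\in\mathbb{N}$; a descendant of $\tau$ in $T$ is a node of $T$ of the form $\tau\cdot\tau'$, $\tau'\in\mathbb{N}^*$ (so $\tau$ is a descendant of itself). A subtree of $T$ is a subset of $T$ that is a tree (with any root). A path of $T$ is a subtree of $T$ each of whose nodes has at most one child in it. $T$ is non-blocking if every node has a child in $T$, and finitely-branching if every node has finitely many children in $T$. For a finite set $AP$ of atomic propositions, a Kripke tree over $AP$ is a pair $(T,\mathrm{Lab})$ with $T$ a non-blocking tree and $\mathrm{Lab}:T\to 2^{AP}$; it is finitely-branching if $T$ is. Logics. Formulas over $AP$ are generated by $\varphi ::= P_a(x)\mid x\le y\mid x\in X\mid \neg\varphi\mid\varphi\wedge\varphi\mid\exists x.\varphi\mid\exists^{\alpha}X.\varphi$, with $a\in AP$, $x,y$ first-order variables, $X$ second-order variables. Over $(T,\mathrm{Lab})$, first-order variables range over nodes of $T$; $P_a(x)$ holds iff $a\in\mathrm{Lab}(x)$; $x\le y$ holds iff $y$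 is a descendant of $x$ in $T$; $x\in X$ is membership; Boolean connectives and $\exists x$ are standard. The range of second-order quantification determines the logic: in MSO (monadic second-order logic) it ranges over all subsets of $T$; in MTL (monadic tree logic) over all subtrees of $T$; in MPL (monadic path logic) over all paths of $T$ (finite or infinite objects in each case). A logic consists of its sentences (formulas without free variables). Expressiveness. Over a class of Kripke trees, two sentences over the same $AP$ are equivalent if they are satisfied by the same members (over $AP$) of the class. $L\le L'$ means that, for every finite $AP$, each $L$-sentence over $AP$ has an equivalent $L'$-sentence over $AP$. $L<L'$ means $L\le L'$ and $L'\not\le L$. -}

module Defs where

open import Data.Fin.Base using (Fin)
import Data.Fin.Subset as Subset
open import Data.List.Base using (List; _++_; _∷ʳ_)
import Data.List.Membership.Propositional as List
open import Data.List.Relation.Binary.Prefix.Heterogeneous using (Prefix)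
open import Data.Nat.Base using (ℕ; suc)
open import Data.Product.Base using (∃; ∃-syntax; _×_)
open import Data.Vec.Base using (Vec; []; _∷_; lookup)
open import Function.Bundles using (_⇔_)
open import Level using (Lift; 0ℓ) renaming (suc to lsuc)
open import Relation.Binary.PropositionalEquality.Core using (_≡_)
open import Relation.Nullary.Negation.Core using (¬_)
open import Relation.Unary using (Pred; _∈_; _⊆_; Satisfiable; U)

Word : Set
Word = List ℕ

WordSet : Set₁
WordSet = Pred Word 0ℓ

IsDescendantOf : Word → Word → Set
IsDescendantOf σ τ = ∃[ τ′ ] σ ≡ τ ++ τ′

record IsTree (T : WordSet) : Set where
  field
    root         : Word
    root∈T       : root ∈ T
    below-root   : ∀ {τ} → τ ∈ T → IsDescendantOf τ root
    prefixClosed : ∀ {τ τ′} → root ++ τ ∈ T → Prefix _≡_ τ′ τ → root ++ τ′ ∈ T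

-- A child τ ∷ʳ n of τ is represented by its direction n.
Children : WordSet → Word → Pred ℕ 0ℓ
Children T τ n = τ ∷ʳ n ∈ T

Finite : Pred ℕ 0ℓ → Set
Finite P = ∃[ ns ] (∀ {n} → n ∈ P → n List.∈ ns)

NonBlocking : WordSet → Set
NonBlocking T = ∀ {τ} → τ ∈ T → Satisfiable (Children T τ)

FinitelyBranching : WordSet → Set
FinitelyBranching T = ∀ {τ} → τ ∈ T → Finite (Children T τ)

IsSubtree : WordSet → WordSet → Set
IsSubtree T X = X ⊆ T × IsTree X

IsPath : WordSet → WordSet → Set
IsPath T X = IsSubtree T X ×
  (∀ {τ} → τ ∈ X → ∀ {m n} → m ∈ Children X τ → n ∈ Children X τ → m ≡ n)

-- The set of atomic propositions is Fin n.  The labelling is total on words so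
-- that it cannot depend on a proof of membership in the tree; its values
-- outside the tree are never inspected by the semantics below.
record KripkeTree (n : ℕ) : Set₁ where
  field
    nodes       : WordSet
    isTree      : IsTree nodes
    nonBlocking : NonBlocking nodes
    label       : Word → Subset.Subset n

data Logic : Set where
  MPL MTL MSO : Logic

Range : Logic → WordSet → WordSet → Set
Range MPL T X = IsPath T X
Range MTL T X = IsSubtree T X
Range MSO T X = X ⊆ T

infixr 6 _∧′_
infix  7 ¬′_
infix  8 _≤′_ _∈′_

-- Formula L n i j: formulas of L over Fin n with i free first-order and j free
-- second-order variables, in de Bruijn style (index zero is bound innermost).
data Formula (L : Logic) (n : ℕ) : ℕ → ℕ → Set where
  P    : ∀ {i j} → Fin n → Fin i → Formula L n i j
  _≤′_ : ∀ {i j} → Fin i → Fin i → Formula L n i j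
  _∈′_ : ∀ {i j} → Fin i → Fin j → Formula L n i j
  ¬′_  : ∀ {i j} → Formula L n i j → Formula L n i j
  _∧′_ : ∀ {i j} → Formula L n i j → Formula L n i j → Formula L n i j
  ∃₁   : ∀ {i j} → Formula L n (suc i) j → Formula L n i j
  ∃₂   : ∀ {i j} → Formula L n i (suc j) → Formula L n i j

Sentence : Logic → ℕ → Set
Sentence L n = Formula L n 0 0

module _ {L : Logic} {n : ℕ} (K : KripkeTree n) where
  open KripkeTree K

  Sat : ∀ {i j} → Vec Word i → Vec WordSet j → Formula L n i j → Set₁
  Sat ρ χ (P a x)  = Lift (lsuc 0ℓ) (a Subset.∈ label (lookup ρ x))
  Sat ρ χ (x ≤′ y) = Lift (lsuc 0ℓ) (IsDescendantOf (lookup ρ y) (lookup ρ x))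
  Sat ρ χ (x ∈′ X) = Lift (lsuc 0ℓ) (lookup ρ x ∈ lookup χ X)
  Sat ρ χ (¬′ φ)   = ¬ Sat ρ χ φ
  Sat ρ χ (φ ∧′ ψ) = Sat ρ χ φ × Sat ρ χ ψ
  Sat ρ χ (∃₁ φ)   = ∃[ τ ] (τ ∈ nodes × Sat (τ ∷ ρ) χ φ)
  Sat ρ χ (∃₂ φ)   = ∃[ X ] (Range L nodes X × Sat ρ (X ∷ χ) φ)

infix 4 _⊨_

_⊨_ : ∀ {L n} → KripkeTree n → Sentence L n → Set₁
K ⊨ φ = Sat K [] [] φ

Class : Set₁
Class = ∀ {n} → Pred (KripkeTree n) 0ℓ

allKripkeTrees : Class
allKripkeTrees = U

finitelyBranchingKripkeTrees : Class
finitelyBranchingKripkeTrees K = FinitelyBranching (KripkeTree.nodes K)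

Equivalent : Class → ∀ {L L′ n} → Sentence L n → Sentence L′ n → Set₁
Equivalent C {n = n} φ ψ = ∀ (K : KripkeTree n) → K ∈ C → K ⊨ φ ⇔ K ⊨ ψ

infix 4 _≼[_]_ _≺[_]_

_≼[_]_ : Logic → Class → Logic → Set₁
L ≼[ C ] L′ =
  ∀ n (φ : Sentence L n) → ∃ λ (ψ : Sentence L′ n) → Equivalent C φ ψ

_≺[_]_ : Logic → Class → Logic → Set₁
L ≺[ C ] L′ = L ≼[ C ] L′ × ¬ (L′ ≼[ C ] L)

{-# OPTIONS --safe #-}
module Submission where

{-
Second-order quantifiers are relativised by "X is a chain" (paths among subtrees) and by
"X has a least element and is convex" (subtrees among sets), which gives both inclusions.

Both separations express the parity of the depth m of the only labelled node on the spine
0ᵏ of a comb.  On a bare ray, MSO expresses it by an alternating set, whereas every subtree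
is an interval.  If each spine node also carries a tooth 0ᵏ1ˡ, a subtree can encode any set
of spine nodes by the teeth it enters, so MTL expresses the parity, whereas every path is
still an interval between two points, the upper one possibly infinite.  So in both cases the
weaker logic has only finitely many natural numbers per variable to refer to, and an
Ehrenfeucht–Fraïssé game on (ℕ, ≤, 0, m), in which distances matter only up to a threshold
that each move doubles, shows that it cannot tell m from m + 1 for large m.
-}

open import Defs
open import Axiom.ExcludedMiddle using (ExcludedMiddle)
open import Data.Empty using (⊥)
open import Data.Fin.Base using (Fin; zero; suc)
open import Data.Fin.Patterns using (0F; 1F; 2F)
import Data.Fin.Subset as Subset
open import Data.List.Base using ([]; _∷_; _++_; _∷ʳ_; length; replicate)
open import Data.List.Membership.Propositional using () renaming (_∈_ to _∈ˡ_)
open import Data.List.Properties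
open import Data.List.Relation.Binary.Prefix.Heterogeneous using (Prefix; []; _∷_)
open import Data.List.Relation.Unary.All as All using (All; []; _∷_)
import Data.List.Relation.Unary.All.Properties as All
open import Data.List.Relation.Unary.Any using (here; there)
open import Data.Nat.Base using (ℕ; zero; suc; _+_; _∸_; _≤_; _<_; z≤n; s≤s; s≤s⁻¹; _⊔_)
open import Data.Nat.Properties
open import Data.Product.Base as Product using (∃; ∃-syntax; _×_; _,_; proj₁; proj₂)
open import Data.Sum.Base as Sum using (_⊎_; inj₁; inj₂; [_,_]′)
open import Data.Unit.Base using (⊤; tt)
open import Data.Vec.Base using (Vec; []; _∷_; lookup; here)
open import Data.Vec.Relation.Binary.Pointwise.Inductive as Pointwise using (Pointwise; []; _∷_)
open import Function.Base using (_∘_; id; flip)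
open import Function.Bundles using (_⇔_; mk⇔; Equivalence)
open import Level using (Lift; lift; lower; 0ℓ) renaming (suc to lsuc)
open import Relation.Binary.Construct.Add.Supremum.NonStrict _≤_
  using (_≤⁺_; [_]; _≤⊤⁺; [≤]-injective; ≤⁺-trans; ≤⁺-total)
import Relation.Binary.Construct.Add.Supremum.Equality as Supremum
open import Relation.Binary.Core using (Rel; _⇒_)
open import Relation.Binary.PropositionalEquality
  using (_≡_; refl; sym; trans; cong; cong₂; subst; subst₂)
open import Relation.Nullary.Construct.Add.Supremum using (_⁺; [_]; ⊤⁺)
open import Relation.Nullary.Decidable using (yes; no; does; map′; decidable-stable)
open import Relation.Nullary.Negation using (¬_; contradiction)
open import Relation.Unary using (_∈_; _⊆_)

-- Words under the prefix order, and trees as rooted convex sets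

infix 4 _⊑_

_⊑_ : Word → Word → Set
τ ⊑ σ = IsDescendantOf σ τ

⊑-refl : ∀ {σ} → σ ⊑ σ
⊑-refl = [] , sym (++-identityʳ _)

⊑-trans : ∀ {ρ σ τ} → ρ ⊑ σ → σ ⊑ τ → ρ ⊑ τ
⊑-trans {ρ} (u , refl) (v , refl) = u ++ v , ++-assoc ρ u v

⊑-∷ʳ : ∀ {τ n} → τ ⊑ τ ∷ʳ n
⊑-∷ʳ = _ ∷ [] , refl

∷ʳ-⊑-injective : ∀ τ {m n} → τ ∷ʳ m ⊑ τ ∷ʳ n → m ≡ n
∷ʳ-⊑-injective τ (u , eq) =
  sym (∷-injectiveˡ (++-cancelˡ τ _ _ (trans eq (++-assoc τ (_ ∷ []) u))))

∷ʳ-⋢ : ∀ τ {n} → ¬ τ ∷ʳ n ⊑ τ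
∷ʳ-⋢ τ {n} (u , eq)
  with () ← ++-cancelˡ τ _ _ (trans (++-identityʳ τ) (trans eq (++-assoc τ (n ∷ []) u)))

child-interval : ∀ τ {n σ} → τ ⊑ σ → σ ⊑ τ ∷ʳ n → σ ⊑ τ ⊎ τ ∷ʳ n ⊑ σ
child-interval τ ([] , refl) _ = inj₁ ([] , sym (trans (++-identityʳ _) (++-identityʳ _)))
child-interval τ (a ∷ u , refl) (v , eq)
  with u | v | ++-cancelˡ τ _ _ (trans eq (++-assoc τ (a ∷ u) v))
... | [] | [] | refl = inj₂ ⊑-refl

⊑-antisym : ∀ {σ τ} → σ ⊑ τ → τ ⊑ σ → σ ≡ τ
⊑-antisym {σ} (u , refl) (v , eq)
  with refl ← ++-conicalˡ u v (++-cancelˡ σ _ _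
    (trans (sym (++-assoc σ u v)) (trans (sym eq) (sym (++-identityʳ σ))))) = sym (++-identityʳ σ)

Prefix⇒⊑ : ∀ {σ τ : Word} → Prefix _≡_ σ τ → σ ⊑ τ
Prefix⇒⊑ []          = _ , refl
Prefix⇒⊑ (refl ∷ σ≤τ) = Product.map₂ (cong (_ ∷_)) (Prefix⇒⊑ σ≤τ)

++⇒Prefix : ∀ (σ : Word) {τ} → Prefix _≡_ σ (σ ++ τ)
++⇒Prefix []      = []
++⇒Prefix (_ ∷ σ) = refl ∷ ++⇒Prefix σ

Chain : WordSet → Set
Chain X = ∀ {σ τ} → σ ∈ X → τ ∈ X → σ ⊑ τ ⊎ τ ⊑ σ

-- The purely order-theoretic form of `IsTree`: a least element and convexity are what a formula
-- over the descendant order can state.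
record IsRooted (X : WordSet) (r : Word) : Set where
  constructor mkRooted
  field
    root∈  : r ∈ X
    below  : ∀ {σ} → σ ∈ X → r ⊑ σ
    convex : ∀ {σ τ} → σ ∈ X → r ⊑ τ → τ ⊑ σ → τ ∈ X

rooted⇒tree : ∀ {X r} → IsRooted X r → IsTree X
rooted⇒tree {X} {r} R = record
  { root         = r
  ; root∈T       = root∈
  ; below-root   = below
  ; prefixClosed = closed
  }
  where
  open IsRooted R
  closed : ∀ {τ τ′} → r ++ τ ∈ X → Prefix _≡_ τ′ τ → r ++ τ′ ∈ X
  closed {τ} {τ′} ∈X p with Prefix⇒⊑ p
  ... | u , refl = convex ∈X (τ′ , refl) (u , sym (++-assoc r τ′ u))

tree⇒rooted : ∀ {X} (t : IsTree X) → IsRooted X (IsTree.root t)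
tree⇒rooted {X} t = mkRooted root∈T below-root convex
  where
  open IsTree t
  convex : ∀ {σ τ} → σ ∈ X → root ⊑ τ → τ ⊑ σ → τ ∈ X
  convex ∈X (u , refl) (v , refl) =
    prefixClosed (subst X (++-assoc root u v) ∈X) (++⇒Prefix u)

tree-convex : ∀ {X ρ σ τ} → IsTree X → ρ ∈ X → σ ∈ X → ρ ⊑ τ → τ ⊑ σ → τ ∈ X
tree-convex t ρ∈X σ∈X ρ⊑τ = convex σ∈X (⊑-trans (below ρ∈X) ρ⊑τ)
  where open IsRooted (tree⇒rooted t)

-- Both words extend the root. `go` moves their common prefix `c` down inside `X`: while both
-- continue, convexity puts the next prefixes into `X` and uniqueness of the child forces equal
-- letters.
path⇒chain : ∀ {T X} → IsPath T X → Chain X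
path⇒chain {T} {X} ((_ , t) , unique) σ∈X τ∈X with below-root σ∈X | below-root τ∈X
  where open IsTree t
... | u , refl | v , refl = go root u v root∈T σ∈X τ∈X
  where
  open IsTree t
  go : ∀ c u v → c ∈ X → c ++ u ∈ X → c ++ v ∈ X → c ++ u ⊑ c ++ v ⊎ c ++ v ⊑ c ++ u
  go c []      v       _   _   _   = inj₁ (v , sym (cong (_++ v) (++-identityʳ c)))
  go c (_ ∷ u) []      _   _   _   = inj₂ (_ ∷ u , sym (cong (_++ _ ∷ u) (++-identityʳ c)))
  go c (a ∷ u) (b ∷ v) c∈X u∈X v∈X
    with unique c∈X (step u u∈X) (step v v∈X)
    where
    step : ∀ {a} u → c ++ a ∷ u ∈ X → c ∷ʳ a ∈ X
    step u ∈X = tree-convex t c∈X ∈X ⊑-∷ʳ (u , sym (∷ʳ-++ c _ u))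
  ... | refl = subst (λ ws → proj₁ ws ⊑ proj₂ ws ⊎ proj₂ ws ⊑ proj₁ ws)
    (cong₂ _,_ (∷ʳ-++ c a u) (∷ʳ-++ c a v))
    (go (c ∷ʳ a) u v (tree-convex t c∈X u∈X ⊑-∷ʳ (u , sym (∷ʳ-++ c a u)))
      (subst X (sym (∷ʳ-++ c a u)) u∈X) (subst X (sym (∷ʳ-++ c a v)) v∈X))

chain⇒path : ∀ {T X} → IsSubtree T X → Chain X → IsPath T X
chain⇒path s chain = s , λ {τ} _ m∈ n∈ →
  [ ∷ʳ-⊑-injective τ , sym ∘ ∷ʳ-⊑-injective τ ]′ (chain m∈ n∈)

-- Relativisation

module _ {L L′ : Logic} {n : ℕ} (guard : ∀ {i j} → Formula L′ n i (suc j)) where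

  relativise : ∀ {i j} → Formula L n i j → Formula L′ n i j
  relativise (P a x)  = P a x
  relativise (x ≤′ y) = x ≤′ y
  relativise (x ∈′ X) = x ∈′ X
  relativise (¬′ φ)   = ¬′ relativise φ
  relativise (φ ∧′ ψ) = relativise φ ∧′ relativise ψ
  relativise (∃₁ φ)   = ∃₁ (relativise φ)
  relativise (∃₂ φ)   = ∃₂ (guard ∧′ relativise φ)

  module _ (K : KripkeTree n)
    (guards : ∀ {i j X} (ρ : Vec Word i) (χ : Vec WordSet j) →
      Range L (KripkeTree.nodes K) X ⇔
      (Range L′ (KripkeTree.nodes K) X × Sat K ρ (X ∷ χ) guard))
    where

    -- The two directions need a mutual induction because negation exchanges them.
    relativise⁺ : ∀ {i j} {ρ : Vec Word i} {χ : Vec WordSet j} φ →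
      Sat K ρ χ φ → Sat K ρ χ (relativise φ)
    relativise⁻ : ∀ {i j} {ρ : Vec Word i} {χ : Vec WordSet j} φ →
      Sat K ρ χ (relativise φ) → Sat K ρ χ φ

    relativise⁺ (P a x)  s = s
    relativise⁺ (x ≤′ y) s = s
    relativise⁺ (x ∈′ X) s = s
    relativise⁺ (¬′ φ)   s = s ∘ relativise⁻ φ
    relativise⁺ (φ ∧′ ψ) s = Product.map (relativise⁺ φ) (relativise⁺ ψ) s
    relativise⁺ (∃₁ φ) (τ , τ∈T , s) = τ , τ∈T , relativise⁺ φ s
    relativise⁺ (∃₂ φ) (X , r , s) with Equivalence.to (guards _ _) r
    ... | r′ , g = X , r′ , g , relativise⁺ φ s

    relativise⁻ (P a x)  s = s
    relativise⁻ (x ≤′ y) s = s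
    relativise⁻ (x ∈′ X) s = s
    relativise⁻ (¬′ φ)   s = s ∘ relativise⁺ φ
    relativise⁻ (φ ∧′ ψ) s = Product.map (relativise⁻ φ) (relativise⁻ ψ) s
    relativise⁻ (∃₁ φ) (τ , τ∈T , s) = τ , τ∈T , relativise⁻ φ s
    relativise⁻ (∃₂ φ) (X , r′ , g , s) =
      X , Equivalence.from (guards _ _) (r′ , g) , relativise⁻ φ s

chainFormula : ∀ {L n i j} → Formula L n i (suc j)
chainFormula = ¬′ ∃₁ (∃₁ (0F ∈′ 0F ∧′ 1F ∈′ 0F ∧′ ¬′ 0F ≤′ 1F ∧′ ¬′ 1F ≤′ 0F))

-- The witness is the root; the three conjuncts are the fields of `IsRooted`, the last two stated as
-- the absence of a counterexample.
treeFormula : ∀ {L n i j} → Formula L n i (suc j)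
treeFormula = ∃₁ (0F ∈′ 0F
  ∧′ ¬′ ∃₁ (0F ∈′ 0F ∧′ ¬′ 1F ≤′ 0F)
  ∧′ ¬′ ∃₁ (∃₁ (1F ∈′ 0F ∧′ 2F ≤′ 0F ∧′ 0F ≤′ 1F ∧′ ¬′ 0F ∈′ 0F)))

module Classical (em : ExcludedMiddle (lsuc 0ℓ)) where

  em₀ : ExcludedMiddle 0ℓ
  em₀ {A} = map′ lower lift (em {Lift _ A})

  stable : {A : Set} → ¬ ¬ A → A
  stable = decidable-stable em₀

  module _ {n : ℕ} (K : KripkeTree n) where
    open KripkeTree K

    path⇔chain : ∀ {i j X} (ρ : Vec Word i) (χ : Vec WordSet j) →
      IsPath nodes X ⇔ (IsSubtree nodes X × Sat {MTL} K ρ (X ∷ χ) chainFormula)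
    path⇔chain {X = X} ρ χ = mk⇔ to from
      where
      to : IsPath nodes X → IsSubtree nodes X × Sat {MTL} K ρ (X ∷ χ) chainFormula
      to p = proj₁ p , λ where
        (τ , _ , σ , _ , lift σ∈X , lift τ∈X , τ⋢σ , σ⋢τ) →
          [ τ⋢σ ∘ lift , σ⋢τ ∘ lift ]′ (path⇒chain p σ∈X τ∈X)
      from : IsSubtree nodes X × Sat {MTL} K ρ (X ∷ χ) chainFormula → IsPath nodes X
      from (s@(X⊆T , _) , ¬incomparable) = chain⇒path s λ σ∈X τ∈X → stable λ ¬c →
        ¬incomparable (_ , X⊆T τ∈X , _ , X⊆T σ∈X , lift σ∈X , lift τ∈X ,
          ¬c ∘ inj₁ ∘ lower , ¬c ∘ inj₂ ∘ lower)

    subtree⇔rooted : ∀ {i j X} (ρ : Vec Word i) (χ : Vec WordSet j) →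
      IsSubtree nodes X ⇔ (X ⊆ nodes × Sat {MSO} K ρ (X ∷ χ) treeFormula)
    subtree⇔rooted {X = X} ρ χ = mk⇔ to from
      where
      to : IsSubtree nodes X → X ⊆ nodes × Sat {MSO} K ρ (X ∷ χ) treeFormula
      to (X⊆T , t) = X⊆T , _ , X⊆T root∈ , lift root∈ ,
        (λ where (_ , _ , lift σ∈X , r⋢σ) → r⋢σ (lift (below σ∈X))) ,
        (λ where (_ , _ , _ , _ , lift σ∈X , lift r⊑τ , lift τ⊑σ , τ∉X) →
                   τ∉X (lift (convex σ∈X r⊑τ τ⊑σ)))
        where open IsRooted (tree⇒rooted t)
      from : X ⊆ nodes × Sat {MSO} K ρ (X ∷ χ) treeFormula → IsSubtree nodes X
      from (X⊆T , r , r∈T , lift r∈X , ¬outside , ¬gap) = X⊆T , rooted⇒tree (mkRooted r∈X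
        (λ σ∈X → stable λ r⋢σ → ¬outside (_ , X⊆T σ∈X , lift σ∈X , r⋢σ ∘ lower))
        (λ σ∈X r⊑τ τ⊑σ → stable λ τ∉X → ¬gap (_ , X⊆T σ∈X , _ ,
          tree-convex isTree r∈T (X⊆T σ∈X) r⊑τ τ⊑σ ,
          lift σ∈X , lift r⊑τ , lift τ⊑σ , τ∉X ∘ lower)))

  MPL≼MTL : ∀ (C : Class) → MPL ≼[ C ] MTL
  MPL≼MTL C n φ = relativise chainFormula φ , λ K _ →
    mk⇔ (relativise⁺ _ K (path⇔chain K) φ) (relativise⁻ _ K (path⇔chain K) φ)

  MTL≼MSO : ∀ (C : Class) → MTL ≼[ C ] MSO
  MTL≼MSO C n φ = relativise treeFormula φ , λ K _ →
    mk⇔ (relativise⁺ _ K (subtree⇔rooted K) φ) (relativise⁻ _ K (subtree⇔rooted K) φ)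

-- Matching natural numbers up to a distance threshold

Forth : ℕ → Rel ℕ 0ℓ → Set
Forth d M = ∀ {k k′ l l′ c} → c ≤ d → M k k′ → M l l′ → k + c ≤ l → k′ + c ≤ l′

-- M relates numbers of two copies of ℕ; signed distances up to d are preserved
-- exactly, larger ones only have to stay larger than d.
record Similar (d : ℕ) (M : Rel ℕ 0ℓ) : Set where
  constructor mkSimilar
  field
    forth : Forth d M
    back  : Forth d (flip M)

open Similar

module _ {M : Rel ℕ 0ℓ} where

  similar-flip : ∀ {d} → Similar d M → Similar d (flip M)
  similar-flip S = mkSimilar (back S) (forth S)

  similar-weaken : ∀ {d e} → d ≤ e → Similar e M → Similar d M
  similar-weaken d≤e S =
    mkSimilar (λ c≤d → forth S (≤-trans c≤d d≤e)) (λ c≤d → back S (≤-trans c≤d d≤e))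

  similar-mono : ∀ {d k k′ l l′} → Similar d M → M k k′ → M l l′ → k ≤ l → k′ ≤ l′
  similar-mono {k = k} {k′} {l} {l′} S kk′ ll′ k≤l = subst (_≤ l′) (+-identityʳ k′)
    (forth S z≤n kk′ ll′ (subst (_≤ l) (sym (+-identityʳ k)) k≤l))

  similar-functional : ∀ {d k k′ k″} → Similar d M → M k k′ → M k k″ → k′ ≡ k″
  similar-functional S p q =
    ≤-antisym (similar-mono S p q ≤-refl) (similar-mono S q p ≤-refl)

  -- Cancel the smaller of `c` and `e`. If `c` remains, `forth` applies; if `e` remains, the
  -- contrapositive is a strict inequality, which `back` handles at distance `suc (e ∸ c)`. Hence
  -- the threshold `suc d`.
  similar-shift : ∀ {d k k′ l l′} c e → c ≤ d → e ≤ d → Similar (suc d) M →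
    M k k′ → M l l′ → k + c ≤ l + e → k′ + c ≤ l′ + e
  similar-shift {d} {k} {k′} {l} {l′} c e c≤d e≤d S kk′ ll′ k+c≤l+e with ≤-total e c
  ... | inj₁ e≤c = expand (forth S (≤-trans (m∸n≤m c e) (m≤n⇒m≤1+n c≤d)) kk′ ll′
          (+-cancelʳ-≤ e _ _ (subst (_≤ l + e) (split k) k+c≤l+e)))
    where
    split : ∀ k → k + c ≡ k + (c ∸ e) + e
    split k = trans (cong (k +_) (sym (m∸n+n≡m e≤c))) (sym (+-assoc k (c ∸ e) e))
    expand : k′ + (c ∸ e) ≤ l′ → k′ + c ≤ l′ + e
    expand p = subst (_≤ l′ + e) (sym (split k′)) (+-monoˡ-≤ e p)
  ... | inj₂ c≤e = ≮⇒≥ λ l′+e<k′+c → <⇒≱ (shrink⁻¹ l k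
          (back S (s≤s (≤-trans (m∸n≤m e c) e≤d)) ll′ kk′ (shrink l′ k′ l′+e<k′+c))) k+c≤l+e
    where
    split : ∀ l → l + e ≡ l + (e ∸ c) + c
    split l = trans (cong (l +_) (sym (m∸n+n≡m c≤e))) (sym (+-assoc l (e ∸ c) c))
    shrink : ∀ l k → l + e < k + c → l + suc (e ∸ c) ≤ k
    shrink l k p = subst (_≤ k) (sym (+-suc l _))
      (+-cancelʳ-≤ c _ _ (subst (_< k + c) (split l) p))
    shrink⁻¹ : ∀ l k → l + suc (e ∸ c) ≤ k → l + e < k + c
    shrink⁻¹ l k p = subst (_< k + c) (sym (split l))
      (+-monoˡ-≤ c (subst (_≤ k) (+-suc l _) p))

Adjoin : Rel ℕ 0ℓ → ℕ → ℕ → Rel ℕ 0ℓ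
Adjoin M a b k k′ = M k k′ ⊎ (k ≡ a × k′ ≡ b)

-- One direction of what similarity demands of a new pair against the old ones.
Fits : ℕ → Rel ℕ 0ℓ → ℕ → ℕ → Set
Fits d M a b = ∀ {k k′ c} → M k k′ → c ≤ d →
  (k + c ≤ a → k′ + c ≤ b) × (a + c ≤ k → b + c ≤ k′)

adjoin-forth : ∀ {d M a b} → Forth d M → Fits d M a b → Forth d (Adjoin M a b)
adjoin-forth F fits c≤d (inj₁ p)             (inj₁ q)             = F c≤d p q
adjoin-forth F fits c≤d (inj₁ p)             (inj₂ (refl , refl)) = proj₁ (fits p c≤d)
adjoin-forth F fits c≤d (inj₂ (refl , refl)) (inj₁ q)             = proj₂ (fits q c≤d)
adjoin-forth {a = a} {b} F fits {c = c} c≤d (inj₂ (refl , refl)) (inj₂ (refl , refl)) a+c≤a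
  with z≤n ← +-cancelˡ-≤ a c 0 (subst (a + c ≤_) (sym (+-identityʳ a)) a+c≤a) =
  ≤-reflexive (+-identityʳ b)

similar-adjoin : ∀ {d M a b} → Similar d M → Fits d M a b → Fits d (flip M) b a →
  Similar d (Adjoin M a b)
similar-adjoin {d} {M} {a} {b} S fits fits′ = mkSimilar
  (adjoin-forth (forth S) fits)
  (λ c≤d p q → adjoin-forth {d} {flip M} (back S) fits′ c≤d
    (Sum.map₂ Product.swap p) (Sum.map₂ Product.swap q))

-- The least gap between two numbers that leaves room for a third at distance greater than `d` from
-- both.
grow : ℕ → ℕ
grow d = 2 + (d + d)

d≤1+d+d : ∀ d → d ≤ suc (d + d)
d≤1+d+d d = m≤n⇒m≤1+n (m≤m+n d d)

d≤grow : ∀ d → d ≤ grow d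
d≤grow d = m≤n⇒m≤1+n (d≤1+d+d d)

module _ {M : Rel ℕ 0ℓ} {d : ℕ} where

  -- Comparing at distance `c` with `k + e` amounts to comparing with `k` at a signed distance of
  -- size at most `d + d`, which the larger threshold preserves.
  fits-above : ∀ {k k′ e} → Similar (grow d) M → M k k′ → e ≤ d → Fits d M (k + e) (k′ + e)
  fits-above {k} {k′} {e} S kk′ e≤d {l} {l′} {c} ll′ c≤d =
    similar-shift c e c≤d e≤d (similar-weaken (s≤s (d≤1+d+d d)) S) ll′ kk′ ,
    λ p → subst (_≤ l′) (sym (+-assoc k′ e c))
      (forth S (m≤n⇒m≤1+n (m≤n⇒m≤1+n (+-mono-≤ e≤d c≤d))) kk′ ll′
        (subst (_≤ l) (+-assoc k e c) p))

  fits-below : ∀ {a b e} → Similar (grow d) M → M (a + e) (b + e) → e ≤ d → Fits d M a b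
  fits-below {a} {b} {e} S kk′ e≤d {l} {l′} {c} ll′ c≤d =
    (λ p → +-cancelʳ-≤ e _ _ (subst (_≤ b + e) (sym (+-assoc l′ c e))
      (forth S (m≤n⇒m≤1+n (m≤n⇒m≤1+n (+-mono-≤ c≤d e≤d))) ll′ kk′
        (subst (_≤ a + e) (+-assoc l c e) (+-monoˡ-≤ e p))))) ,
    λ p → +-cancelʳ-≤ e _ _ (subst (_≤ l′ + e) (swap b c)
      (similar-shift c e c≤d e≤d (similar-weaken (s≤s (d≤1+d+d d)) S) kk′ ll′
        (subst (_≤ l + e) (sym (swap a c)) (+-monoˡ-≤ e p))))
    where
    swap : ∀ a c → a + e + c ≡ a + c + e
    swap a c = trans (+-assoc a e c) (trans (cong (a +_) (+-comm e c)) (sym (+-assoc a c e)))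

  -- Beyond distance `d` the side decides every comparison: either its conclusion holds outright or
  -- its premise fails.
  fits-far : ∀ {a b} →
    (∀ {k k′} → M k k′ → (k + d < a × k′ + d < b) ⊎ (a + d < k × b + d < k′)) → Fits d M a b
  fits-far far {k} {k′} {c} kk′ c≤d with far kk′
  ... | inj₁ (p , p′) =
    (λ _ → ≤-trans (+-monoʳ-≤ k′ c≤d) (<⇒≤ p′)) ,
    (λ q → contradiction (≤-trans (m≤m+n _ c) q) (<⇒≱ (≤-<-trans (m≤m+n _ d) p)))
  ... | inj₂ (p , p′) =
    (λ q → contradiction (≤-trans (m≤m+n _ c) q) (<⇒≱ (≤-<-trans (m≤m+n _ d) p))) ,
    (λ _ → ≤-trans (+-monoʳ-≤ _ c≤d) (<⇒≤ p′))

-- The initial position of the game: the two origins and the two labelled depths are matched.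
marks-similar : ∀ {d m m′} → d < m → d < m′ → Similar d (Adjoin (Adjoin (λ _ _ → ⊥) 0 0) m m′)
marks-similar {d} d<m d<m′ = similar-adjoin
  (similar-adjoin (mkSimilar (λ _ ()) (λ _ ())) (λ ()) (λ ())) (fits d<m d<m′) (fits′ d<m′ d<m)
  where
  fits : ∀ {m m′} → d < m → d < m′ → Fits d (Adjoin (λ _ _ → ⊥) 0 0) m m′
  fits (s≤s _) d<m′ (inj₂ (refl , refl)) c≤d = (λ _ → ≤-trans c≤d (<⇒≤ d<m′)) , λ ()
  fits′ : ∀ {m m′} → d < m → d < m′ → Fits d (flip (Adjoin (λ _ _ → ⊥) 0 0)) m m′
  fits′ (s≤s _) d<m′ (inj₂ (refl , refl)) c≤d = (λ _ → ≤-trans c≤d (<⇒≤ d<m′)) , λ ()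

-- The initial threshold that suffices for the game. A quantifier pays one `grow` per coordinate:
-- two for a node, four for the two end points of a path.
cost : ∀ {L i j} → Formula L 1 i j → ℕ
cost (P a x)  = 0
cost (x ≤′ y) = 0
cost (x ∈′ X) = 0
cost (¬′ φ)   = cost φ
cost (φ ∧′ ψ) = cost φ ⊔ cost ψ
cost (∃₁ φ)   = grow (grow (cost φ))
cost (∃₂ φ)   = grow (grow (grow (grow (cost φ))))

-- Suprema of sets of numbers, and answers to moves of the game

module Selection (em : ExcludedMiddle (lsuc 0ℓ)) where
  open Classical em

  bounded-max : {Q : ℕ → Set} → ∃ Q → ∀ N → (∀ {n} → Q n → n ≤ N) →
    ∃[ m ] (Q m × (∀ {n} → Q n → n ≤ m))
  bounded-max {Q} (n , q) N bound with em₀ {Q N}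
  ... | yes qN = N , qN , bound
  bounded-max {Q} (n , q) zero bound | no ¬qN = contradiction (subst Q (n≤0⇒n≡0 (bound q)) q) ¬qN
  bounded-max {Q} (n , q) (suc N) bound | no ¬qN = bounded-max (n , q) N λ r →
    [ s≤s⁻¹ , (λ eq → contradiction (subst Q eq r) ¬qN) ]′ (m≤n⇒m<n∨m≡n (bound r))

  -- Leastness is stated as cofinality, which for a supremum `⊤⁺` says that `Q` is unbounded.
  supremum : {Q : ℕ → Set} → ∃ Q → ∃[ s ] ((∀ {n} → Q n → [ n ] ≤⁺ s) ×
    (∀ {n} → [ n ] ≤⁺ s → ∃[ n′ ] (n ≤ n′ × Q n′)))
  supremum {Q} inhabited with em₀ {∃[ N ] (∀ {n} → Q n → n ≤ N)}
  ... | yes (N , bound) with bounded-max inhabited N bound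
  ...   | m , qm , max = [ m ] , (λ q → [ max q ]) , λ n≤m → m , [≤]-injective n≤m , qm
  supremum {Q} inhabited | no unbounded = ⊤⁺ , (λ _ → _ ≤⊤⁺) , λ {n} _ → stable λ none →
    unbounded (n , λ q → ≮⇒≥ λ n<n′ → none (_ , <⇒≤ n<n′ , q))

  -- An element within distance d of a matched one is answered at the same distance from its
  -- partner; any other one just beyond distance d above the partner of its predecessor.
  extend : ∀ {d M} → M 0 0 → Similar (grow d) M → ∀ a → ∃[ b ] Similar d (Adjoin M a b)
  extend {d} {M} zeros S a
    with em₀ {∃[ k ] ∃[ k′ ] ∃[ e ] (M k k′ × e ≤ d × a ≡ k + e)}
       | em₀ {∃[ k ] ∃[ k′ ] ∃[ e ] (M k k′ × e ≤ d × a + e ≡ k)}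
  ... | yes (k , k′ , e , kk′ , e≤d , refl) | _ = k′ + e ,
    similar-adjoin S′ (fits-above S kk′ e≤d) (fits-above (similar-flip S) kk′ e≤d)
    where S′ = similar-weaken (d≤grow d) S
  ... | no _ | yes (_ , k′ , e , kk′ , e≤d , refl) = k′ ∸ e ,
    similar-adjoin S′ (fits-below S kk″ e≤d) (fits-below (similar-flip S) kk″ e≤d)
    where
    S′ = similar-weaken (d≤grow d) S
    -- Since 0 is matched with 0, `e ≤ k` carries over to `e ≤ k′`, so the truncated subtraction is
    -- exact.
    kk″ : M (a + e) (k′ ∸ e + e)
    kk″ = subst (M (a + e)) (sym (m∸n+n≡m e≤k′)) kk′
      where e≤k′ = forth S (≤-trans e≤d (d≤grow d)) zeros kk′ (m≤n+m e a)
  ... | no ¬above | no ¬below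
    -- The matched predecessor of `a` exists because 0 is matched.
    with bounded-max {λ k → k ≤ a × ∃[ k′ ] M k k′} (0 , z≤n , 0 , zeros) a proj₁
  ...   | k₀ , (k₀≤a , k₀′ , kk₀) , max = suc (k₀′ + d) ,
    similar-adjoin S′ (fits-far far)
      (fits-far {M = flip M} (Sum.map Product.swap Product.swap ∘ far))
    where
    S′ = similar-weaken (d≤grow d) S
    far-above : ∀ {k k′} → M k k′ → k ≤ a → k + d < a
    far-above {k} kk′ k≤a = ≰⇒> λ a≤k+d →
      ¬above (k , _ , a ∸ k , kk′ , m≤n+o⇒m∸n≤o a k a≤k+d , sym (m+[n∸m]≡n k≤a))
    far-below : ∀ {k k′} → M k k′ → a ≤ k → a + d < k
    far-below {k} kk′ a≤k = ≰⇒> λ k≤a+d →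
      ¬below (k , _ , k ∸ a , kk′ , m≤n+o⇒m∸n≤o k a k≤a+d , m+[n∸m]≡n a≤k)
    regroup : ∀ x → x + grow d ≡ suc (suc (x + d) + d)
    regroup x = trans (+-suc x _) (cong suc (trans (+-suc x _) (cong suc (sym (+-assoc x d d)))))
    far : ∀ {k k′} → M k k′ →
      (k + d < a × k′ + d < suc (k₀′ + d)) ⊎ (a + d < k × suc (k₀′ + d) + d < k′)
    far {k} {k′} kk′ with ≤-total k a
    ... | inj₁ k≤a = inj₁ (far-above kk′ k≤a ,
      s≤s (+-monoˡ-≤ d (similar-mono S kk′ kk₀ (max (k≤a , _ , kk′)))))
    ... | inj₂ a≤k = inj₂ (far-below kk′ a≤k , subst (_≤ k′) (regroup k₀′)
      (forth S ≤-refl kk₀ kk′ (subst (_≤ k) (sym (regroup k₀))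
        (≤-trans (s≤s (+-monoˡ-≤ d (far-above kk₀ k₀≤a))) (far-below kk′ a≤k)))))

  extend⁺ : ∀ {d M} → M 0 0 → Similar (grow d) M → ∀ s →
    ∃[ M′ ] ∃[ s′ ] (M ⇒ M′ × Similar d M′ × Supremum._≈⁺_ M′ s s′)
  extend⁺ zeros S [ a ] with extend zeros S a
  ... | b , S′ = _ , [ b ] , inj₁ , S′ , Supremum.[ inj₂ (refl , refl) ]
  extend⁺ {d} {M} zeros S ⊤⁺ = M , ⊤⁺ , id ,
    similar-weaken (d≤grow d) S , Supremum.⊤⁺≈⊤⁺

-- Combs and their paths

-- The point (k , l) stands for the word 0ᵏ1ˡ; points with an infinite coordinate
-- are the suprema of infinite paths.
Point : Set
Point = ℕ ⁺ × ℕ ⁺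

at : ℕ → ℕ → Point
at k l = [ k ] , [ l ]

infix 4 _⊴_

-- The prefix order in coordinates: the lower point is on the spine, or both points lie in one
-- column. Equality of columns is written as two inequalities, so that only `≤⁺` and 0 occur, which
-- matchings preserve.
_⊴_ : Point → Point → Set
(k , l) ⊴ (k′ , l′) = k ≤⁺ k′ × (l ≤⁺ [ 0 ] ⊎ (k′ ≤⁺ k × l ≤⁺ l′))

⊴-trans : ∀ {p q r} → p ⊴ q → q ⊴ r → p ⊴ r
⊴-trans (k≤k′ , inj₁ l≤0) (k′≤k″ , _) = ≤⁺-trans ≤-trans k≤k′ k′≤k″ , inj₁ l≤0
⊴-trans (k≤k′ , inj₂ (_ , l≤l′)) (k′≤k″ , inj₁ l′≤0) =
  ≤⁺-trans ≤-trans k≤k′ k′≤k″ , inj₁ (≤⁺-trans ≤-trans l≤l′ l′≤0)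
⊴-trans (k≤k′ , inj₂ (k′≤k , l≤l′)) (k′≤k″ , inj₂ (k″≤k′ , l′≤l″)) =
  ≤⁺-trans ≤-trans k≤k′ k′≤k″ ,
  inj₂ (≤⁺-trans ≤-trans k″≤k′ k′≤k , ≤⁺-trans ≤-trans l≤l′ l′≤l″)

-- By symmetry `p` has the smaller first coordinate. Unless `p ⊴ r` holds because `p` is on the
-- spine, all three points share that coordinate.
⊴-comparable : ∀ {p q} r → p ⊴ r → q ⊴ r → p ⊴ q ⊎ q ⊴ p
⊴-comparable {p} {q} r p⊴r q⊴r =
  [ (λ k≤k′ → ordered {p} {q} k≤k′ p⊴r q⊴r)
  , (λ k′≤k → Sum.swap (ordered {q} {p} k′≤k q⊴r p⊴r)) ]′
  (≤⁺-total ≤-total (proj₁ p) (proj₁ q))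
  where
  ordered : ∀ {p q} → proj₁ p ≤⁺ proj₁ q → p ⊴ r → q ⊴ r → p ⊴ q ⊎ q ⊴ p
  ordered k≤k′ (_ , inj₁ l≤0) _ = inj₁ (k≤k′ , inj₁ l≤0)
  ordered k≤k′ (_ , inj₂ (r≤k , _)) (k′≤r , inj₁ l′≤0) =
    inj₂ (≤⁺-trans ≤-trans k′≤r r≤k , inj₁ l′≤0)
  ordered {_ , l} {_ , l′} k≤k′ (_ , inj₂ (r≤k , _)) (k′≤r , inj₂ _) =
    [ (λ l≤l′ → inj₁ (k≤k′ , inj₂ (k′≤k , l≤l′)))
    , (λ l′≤l → inj₂ (k′≤k , inj₂ (k≤k′ , l′≤l))) ]′
    (≤⁺-total ≤-total l l′)
    where k′≤k = ≤⁺-trans ≤-trans k′≤r r≤k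

node : ℕ → ℕ → Word
node zero    l = replicate l 1
node (suc k) l = 0 ∷ node k l

node-⊑⁻ : ∀ k k′ {l l′} → node k l ⊑ node k′ l′ → at k l ⊴ at k′ l′
node-⊑⁻ zero zero {l} {l′} (u , eq) = [ z≤n ] , inj₂ ([ z≤n ] , [ l≤l′ ])
  where
  l≤l′ : l ≤ l′
  l≤l′ = subst₂ _≤_ (length-replicate l)
    (trans (sym (length-++ (replicate l 1))) (trans (cong length (sym eq)) (length-replicate l′)))
    (m≤m+n _ (length u))
node-⊑⁻ zero (suc k′) {zero} _ = [ z≤n ] , inj₁ [ z≤n ]
node-⊑⁻ (suc k) zero {l′ = zero} (_ , ())
node-⊑⁻ (suc k) zero {l′ = suc l′} (_ , ())
node-⊑⁻ (suc k) (suc k′) (u , eq) with node-⊑⁻ k k′ (u , ∷-injectiveʳ eq)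
... | [ k≤k′ ] , inj₁ l≤0 = [ s≤s k≤k′ ] , inj₁ l≤0
... | [ k≤k′ ] , inj₂ ([ k′≤k ] , l≤l′) = [ s≤s k≤k′ ] , inj₂ ([ s≤s k′≤k ] , l≤l′)

node-⊑⁺ : ∀ {k k′ l l′} → at k l ⊴ at k′ l′ → node k l ⊑ node k′ l′
node-⊑⁺ ([ k≤k′ ] , inj₁ [ z≤n ]) = spine k≤k′
  where
  spine : ∀ {k k′ l} → k ≤ k′ → node k 0 ⊑ node k′ l
  spine z≤n       = _ , refl
  spine (s≤s k≤k′) = Product.map₂ (cong (0 ∷_)) (spine k≤k′)
node-⊑⁺ {k} ([ k≤k′ ] , inj₂ ([ k′≤k ] , [ l≤l′ ])) with refl ← ≤-antisym k≤k′ k′≤k = column k l≤l′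
  where
  column : ∀ k {l l′} → l ≤ l′ → node k l ⊑ node k l′
  column zero    z≤n       = _ , refl
  column zero    (s≤s l≤l′) = Product.map₂ (cong (1 ∷_)) (column zero l≤l′)
  column (suc k) l≤l′       = Product.map₂ (cong (0 ∷_)) (column k l≤l′)

at-antisym : ∀ {k k′ l l′} → at k l ⊴ at k′ l′ → at k′ l′ ⊴ at k l → k ≡ k′ × l ≡ l′
at-antisym ([ k≤k′ ] , v) ([ k′≤k ] , w) = ≤-antisym k≤k′ k′≤k , ≤-antisym (levels v) (levels w)
  where
  levels : ∀ {A : Set} {l l′} → [ l ] ≤⁺ [ 0 ] ⊎ (A × [ l ] ≤⁺ [ l′ ]) → l ≤ l′
  levels (inj₁ [ z≤n ])      = z≤n
  levels (inj₂ (_ , [ l≤l′ ])) = l≤l′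

node-injective : ∀ k k′ {l l′} → node k l ≡ node k′ l′ → k ≡ k′ × l ≡ l′
node-injective k k′ {l} eq = at-antisym
  (node-⊑⁻ k k′ (subst (node k l ⊑_) eq ⊑-refl)) (node-⊑⁻ k′ k (subst (_⊑ node k l) eq ⊑-refl))

node-∷ʳ-0 : ∀ k → node k 0 ∷ʳ 0 ≡ node (suc k) 0
node-∷ʳ-0 zero    = refl
node-∷ʳ-0 (suc k) = cong (0 ∷_) (node-∷ʳ-0 k)

node-∷ʳ-1 : ∀ k l → node k l ∷ʳ 1 ≡ node k (suc l)
node-∷ʳ-1 zero    zero    = refl
node-∷ʳ-1 zero    (suc l) = cong (1 ∷_) (node-∷ʳ-1 zero l)
node-∷ʳ-1 (suc k) l       = cong (0 ∷_) (node-∷ʳ-1 k l)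

prefix-node : ∀ k l {u} → u ⊑ node k l → ∃[ k′ ] ∃[ l′ ] (l′ ≤ l × u ≡ node k′ l′)
prefix-node k       l {[]}    _        = 0 , 0 , z≤n , refl
prefix-node (suc k) l {a ∷ u} (v , eq) with prefix-node k l (v , ∷-injectiveʳ eq)
... | k′ , l′ , l′≤l , refl = suc k′ , l′ , l′≤l , cong (_∷ node k′ l′) (sym (∷-injectiveˡ eq))
prefix-node zero    l {u}     u⊑       with prefix-replicate l u⊑
  where
  prefix-replicate : ∀ l {u} → u ⊑ replicate l 1 → ∃[ l′ ] (l′ ≤ l × u ≡ replicate l′ 1)
  prefix-replicate l       {[]}    _ = 0 , z≤n , refl
  prefix-replicate (suc l) {a ∷ u} (v , eq) with prefix-replicate l (v , ∷-injectiveʳ eq)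
  ... | l′ , l′≤l , refl = suc l′ , s≤s l′≤l , cong (_∷ replicate l′ 1) (sym (∷-injectiveˡ eq))
... | l′ , l′≤l , eq = 0 , l′ , l′≤l , eq

node-binary : ∀ k l → All (_∈ˡ 0 ∷ 1 ∷ []) (node k l)
node-binary zero    zero    = []
node-binary zero    (suc l) = there (here refl) ∷ node-binary zero l
node-binary (suc k) l       = here refl ∷ node-binary k l

-- The comb consists of the spine 0ᵏ and, if Teeth is inhabited, the teeth 0ᵏ1ˡ.
module Comb (Teeth : Set) where

  Allowed : ℕ → Set
  Allowed l = l ≤ 0 ⊎ Teeth

  Comb : WordSet
  Comb w = ∃[ k ] ∃[ l ] (Allowed l × w ≡ node k l)

  on-spine : ∀ k → node k 0 ∈ Comb
  on-spine k = k , 0 , inj₁ z≤n , refl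

  comb-rooted : IsRooted Comb []
  comb-rooted = mkRooted (on-spine 0) (λ _ → _ , refl) closed
    where
    closed : ∀ {σ τ} → σ ∈ Comb → [] ⊑ τ → τ ⊑ σ → τ ∈ Comb
    closed (k , l , a , refl) _ τ⊑σ with prefix-node k l τ⊑σ
    ... | k′ , l′ , l′≤l , eq = k′ , l′ , Sum.map₁ (≤-trans l′≤l) a , eq

  comb : ℕ → KripkeTree 1
  comb m = record
    { nodes       = Comb
    ; isTree      = rooted⇒tree comb-rooted
    ; nonBlocking = nonBlocking
    ; label       = λ w → does (≡-dec _≟_ w (node m 0)) ∷ []
    }
    where
    nonBlocking : NonBlocking Comb
    nonBlocking (k , _ , inj₁ z≤n , refl) = 0 , suc k , 0 , inj₁ z≤n , node-∷ʳ-0 k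
    nonBlocking (k , l , inj₂ t   , refl) = 1 , k , suc l , inj₂ t , node-∷ʳ-1 k l

  comb-finitelyBranching : FinitelyBranching Comb
  comb-finitelyBranching {τ} _ = 0 ∷ 1 ∷ [] , λ { (k , l , _ , eq) →
    All.head (All.++⁻ʳ τ (subst (All _) (sym eq) (node-binary k l))) }

  label⁻ : ∀ m {w} → zero Subset.∈ KripkeTree.label (comb m) w → w ≡ node m 0
  label⁻ m {w} ∈l with ≡-dec _≟_ w (node m 0)
  label⁻ m here | yes eq = eq

  label⁺ : ∀ m → zero Subset.∈ KripkeTree.label (comb m) (node m 0)
  label⁺ m with ≡-dec _≟_ (node m 0) (node m 0)
  ... | yes _  = here
  ... | no neq = contradiction refl neq

  Describes : WordSet → Point → Point → Set
  Describes X p q = ∀ {k l} → Allowed l → node k l ∈ X ⇔ (p ⊴ at k l × at k l ⊴ q)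

  Interval : Point → Point → WordSet
  Interval p q w = ∃[ k ] ∃[ l ] (Allowed l × w ≡ node k l × p ⊴ at k l × at k l ⊴ q)

  interval-described : ∀ p q → Describes (Interval p q) p q
  interval-described p q {k} {l} a = mk⇔ to λ (p⊴ , ⊴q) → k , l , a , refl , p⊴ , ⊴q
    where
    to : node k l ∈ Interval p q → p ⊴ at k l × at k l ⊴ q
    to (k′ , l′ , _ , eq , p⊴ , ⊴q) with refl , refl ← node-injective k k′ eq = p⊴ , ⊴q

  ⊴-refl : ∀ {k l} → at k l ⊴ at k l
  ⊴-refl = [ ≤-refl ] , inj₂ ([ ≤-refl ] , [ ≤-refl ])

  -- The start has to be a node, since it becomes the root; `q` may be infinite.
  interval-path : ∀ {k l q} → Allowed l → at k l ⊴ q → IsPath Comb (Interval (at k l) q)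
  interval-path {k} {l} {q} a kl⊴q = chain⇒path (subset , rooted⇒tree rooted) chain
    where
    subset : Interval (at k l) q ⊆ Comb
    subset (k′ , l′ , a′ , eq , _) = k′ , l′ , a′ , eq
    rooted : IsRooted (Interval (at k l) q) (node k l)
    rooted = mkRooted (k , l , a , refl , ⊴-refl , kl⊴q)
      (λ { (k′ , l′ , _ , refl , p⊴ , _) → node-⊑⁺ p⊴ })
      convex
      where
      convex : ∀ {σ τ} → σ ∈ Interval (at k l) q → node k l ⊑ τ → τ ⊑ σ → τ ∈ Interval (at k l) q
      convex σ∈@(k′ , l′ , _ , refl , _ , ⊴q) ⊑τ τ⊑
        with IsRooted.convex comb-rooted (subset σ∈) (_ , refl) τ⊑
      ... | k″ , l″ , a″ , refl = k″ , l″ , a″ , refl , node-⊑⁻ k k″ ⊑τ ,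
        ⊴-trans {at k″ l″} {at k′ l′} {q} (node-⊑⁻ k″ k′ τ⊑) ⊴q
    chain : Chain (Interval (at k l) q)
    chain (k₁ , l₁ , _ , refl , _ , ⊴q₁) (k₂ , l₂ , _ , refl , _ , ⊴q₂) =
      Sum.map node-⊑⁺ node-⊑⁺ (⊴-comparable {at k₁ l₁} {at k₂ l₂} q ⊴q₁ ⊴q₂)

  -- Positions of the game on two combs, and what they preserve

  _≈⁺[_]_ : ℕ ⁺ → Rel ℕ 0ℓ → ℕ ⁺ → Set
  s ≈⁺[ M ] s′ = Supremum._≈⁺_ M s s′

  PointMatch : Rel ℕ 0ℓ → Rel Point 0ℓ
  PointMatch M (k , l) (k′ , l′) = k ≈⁺[ M ] k′ × l ≈⁺[ M ] l′

  NodeMatch : Rel ℕ 0ℓ → Rel Word 0ℓ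
  NodeMatch M σ σ′ = ∃[ k ] ∃[ l ] ∃[ k′ ] ∃[ l′ ]
    (M k k′ × M l l′ × Allowed l × Allowed l′ × σ ≡ node k l × σ′ ≡ node k′ l′)

  -- A set enters the game only through the end points of the interval that it forms.
  record SetMatch (M : Rel ℕ 0ℓ) (X X′ : WordSet) : Set where
    constructor setMatch
    field
      {p q p′ q′} : Point
      start       : PointMatch M p p′
      end         : PointMatch M q q′
      describes   : Describes X p q
      describes′  : Describes X′ p′ q′

  module _ {M N : Rel ℕ 0ℓ} (f : M ⇒ N) where

    ≈⁺-map : ∀ {s s′} → s ≈⁺[ M ] s′ → s ≈⁺[ N ] s′
    ≈⁺-map Supremum.⊤⁺≈⊤⁺ = Supremum.⊤⁺≈⊤⁺
    ≈⁺-map Supremum.[ p ] = Supremum.[ f p ]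

    node-map : ∀ {σ σ′} → NodeMatch M σ σ′ → NodeMatch N σ σ′
    node-map (k , l , k′ , l′ , kk′ , ll′ , rest) = k , l , k′ , l′ , f kk′ , f ll′ , rest

    set-map : ∀ {X X′} → SetMatch M X X′ → SetMatch N X X′
    set-map (setMatch (kk′ , ll′) (hh′ , ii′) D D′) =
      setMatch (≈⁺-map kk′ , ≈⁺-map ll′) (≈⁺-map hh′ , ≈⁺-map ii′) D D′

  module _ {M : Rel ℕ 0ℓ} where

    ≈⁺-flip : ∀ {s s′} → s ≈⁺[ M ] s′ → s′ ≈⁺[ flip M ] s
    ≈⁺-flip Supremum.⊤⁺≈⊤⁺ = Supremum.⊤⁺≈⊤⁺
    ≈⁺-flip Supremum.[ p ] = Supremum.[ p ]

    node-flip : ∀ {σ σ′} → NodeMatch M σ σ′ → NodeMatch (flip M) σ′ σ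
    node-flip (k , l , k′ , l′ , kk′ , ll′ , a , a′ , eq , eq′) =
      k′ , l′ , k , l , kk′ , ll′ , a′ , a , eq′ , eq

    set-flip : ∀ {X X′} → SetMatch M X X′ → SetMatch (flip M) X′ X
    set-flip (setMatch (kk′ , ll′) (hh′ , ii′) D D′) =
      setMatch (≈⁺-flip kk′ , ≈⁺-flip ll′) (≈⁺-flip hh′ , ≈⁺-flip ii′) D′ D

    module _ {d : ℕ} (zeros : M 0 0) (S : Similar d M) where

      ≤⁺-transfer : ∀ {s s′ t t′} → s ≈⁺[ M ] s′ → t ≈⁺[ M ] t′ → s ≤⁺ t → s′ ≤⁺ t′
      ≤⁺-transfer Supremum.[ p ] Supremum.[ q ] [ s≤t ]  = [ similar-mono S p q s≤t ]
      ≤⁺-transfer _              Supremum.⊤⁺≈⊤⁺ (_ ≤⊤⁺) = _ ≤⊤⁺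

      ⊴-transfer : ∀ {p p′ q q′} → PointMatch M p p′ → PointMatch M q q′ → p ⊴ q → p′ ⊴ q′
      ⊴-transfer (kk , ll) (kk′ , ll′) (k≤k′ , v) = ≤⁺-transfer kk kk′ k≤k′ , Sum.map
        (≤⁺-transfer ll Supremum.[ zeros ])
        (Product.map (≤⁺-transfer kk′ kk) (≤⁺-transfer ll ll′)) v

      ⊑-transfer : ∀ {σ σ′ τ τ′} → NodeMatch M σ σ′ → NodeMatch M τ τ′ → σ ⊑ τ → σ′ ⊑ τ′
      ⊑-transfer (k , _ , _ , _ , kk′ , ll′ , _ , _ , refl , refl)
                 (h , _ , _ , _ , hh′ , ii′ , _ , _ , refl , refl) σ⊑τ =
        node-⊑⁺ (⊴-transfer (Supremum.[ kk′ ] , Supremum.[ ll′ ])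
          (Supremum.[ hh′ ] , Supremum.[ ii′ ]) (node-⊑⁻ k h σ⊑τ))

      ∈-transfer : ∀ {σ σ′ X X′} → NodeMatch M σ σ′ → SetMatch M X X′ → σ ∈ X → σ′ ∈ X′
      ∈-transfer (_ , _ , _ , _ , kk′ , ll′ , a , a′ , refl , refl)
                 (setMatch pp′ qq′ D D′) σ∈X =
        Equivalence.from (D′ a′) (Product.map (⊴-transfer pp′ σσ′) (⊴-transfer σσ′ qq′)
          (Equivalence.to (D a) σ∈X))
        where σσ′ = Supremum.[ kk′ ] , Supremum.[ ll′ ]

      spine-transfer : ∀ {m m′ σ σ′} → M m m′ → NodeMatch M σ σ′ →
        σ ≡ node m 0 → σ′ ≡ node m′ 0
      spine-transfer {m} mm′ (k , _ , _ , _ , kk′ , ll′ , _ , _ , refl , refl) eq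
        with refl , refl ← node-injective k m eq =
        cong₂ node (similar-functional S kk′ mm′) (similar-functional S ll′ zeros)

      Allowed-transfer : ∀ {l l′} → M l l′ → Allowed l → Allowed l′
      Allowed-transfer ll′ = Sum.map₁ (similar-mono S ll′ zeros)

  -- Paths of a comb as intervals, and the Ehrenfeucht-Fraïssé argument

  module _ (em : ExcludedMiddle (lsuc 0ℓ)) where
    open Classical em
    open Selection em

    -- The interval starts at the root. If the path meets unboundedly many columns, it stays on the
    -- spine and ends at infinity; otherwise it ends in its last column, at the supremum of the
    -- heights there.
    path-interval : ∀ {X} → IsPath Comb X →
      ∃[ k ] ∃[ l ] ∃[ q ] (Allowed l × at k l ⊴ q × Describes X (at k l) q)
    path-interval {X} p@((X⊆ , t) , _) with X⊆ (IsTree.root∈T t)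
    ... | k₀ , l₀ , a₀ , root≡ = k₀ , l₀ , q , a₀ , ⊴q (subst X root≡ root∈) , λ {k} {l} _ →
        mk⇔ (λ kl∈ → node-⊑⁻ k₀ k (subst (_⊑ node k l) root≡ (below kl∈)) , ⊴q kl∈)
            (λ (p⊴ , ⊴q) → let k′ , l′ , kl′∈ , kl⊴ = cofinal ⊴q in
              convex kl′∈ (subst (_⊑ node k l) (sym root≡) (node-⊑⁺ p⊴)) (node-⊑⁺ kl⊴))
      where
      open IsRooted (tree⇒rooted t)
      comparable : ∀ k k′ {l l′} → node k l ∈ X → node k′ l′ ∈ X →
        at k l ⊴ at k′ l′ ⊎ at k′ l′ ⊴ at k l
      comparable k k′ u v = Sum.map (node-⊑⁻ k k′) (node-⊑⁻ k′ k) (path⇒chain p u v)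
      -- An upper bound below which `X` is cofinal: with convexity, `X` then contains every node
      -- between the root and `q`.
      Upper : Point → Set
      Upper q = (∀ {k l} → node k l ∈ X → at k l ⊴ q) ×
        (∀ {k l} → at k l ⊴ q → ∃[ k′ ] ∃[ l′ ] (node k′ l′ ∈ X × at k l ⊴ at k′ l′))
      upper : ∃ Upper
      upper with supremum {λ k → ∃[ l ] node k l ∈ X} (k₀ , l₀ , subst X root≡ root∈)
      -- With second coordinate 0, either alternative of `⊴` confines the points below to the spine.
      ... | ⊤⁺ , _ , unbounded = (⊤⁺ , [ 0 ]) ,
          (λ {k} {l} kl∈ → (_ ≤⊤⁺) , inj₁ (on-spine-only {k} {l} kl∈)) ,
          λ { {k} (_ , v) → let k′ , k≤k′ , l′ , kl′∈ = unbounded {k} (_ ≤⊤⁺) in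
              k′ , l′ , kl′∈ , [ k≤k′ ] , inj₁ ([ id , proj₂ ]′ v) }
        where
        on-spine-only : ∀ {k l} → node k l ∈ X → [ l ] ≤⁺ [ 0 ]
        on-spine-only {k} kl∈ with unbounded {suc k} (_ ≤⊤⁺)
        ... | k′ , k<k′ , l′ , kl′∈ with comparable k k′ kl∈ kl′∈
        ...   | inj₁ (_ , inj₁ l≤0) = l≤0
        ...   | inj₁ (_ , inj₂ ([ k′≤k ] , _)) = contradiction k′≤k (<⇒≱ k<k′)
        ...   | inj₂ ([ k′≤k ] , _) = contradiction k′≤k (<⇒≱ k<k′)
      ... | [ κ ] , bound , attained
        with attained [ ≤-refl ]
      ...   | κ′ , κ≤κ′ , b , b∈ with refl ← ≤-antisym κ≤κ′ ([≤]-injective (bound (b , b∈)))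
        with supremum {λ l → node κ l ∈ X} (b , b∈)
      ...     | s , s-bound , s-cofinal = ([ κ ] , s) , below-s , above
        where
        below-s : ∀ {k l} → node k l ∈ X → at k l ⊴ ([ κ ] , s)
        below-s {k} {l} kl∈ with <-≤-connex k κ
        ... | inj₂ κ≤k with refl ← ≤-antisym ([≤]-injective (bound (l , kl∈))) κ≤k =
          [ ≤-refl ] , inj₂ ([ ≤-refl ] , s-bound kl∈)
        ... | inj₁ k<κ with comparable k κ kl∈ b∈
        ...   | inj₁ (k≤κ , inj₁ l≤0) = k≤κ , inj₁ l≤0
        ...   | inj₁ (_ , inj₂ ([ κ≤k ] , _)) = contradiction κ≤k (<⇒≱ k<κ)
        ...   | inj₂ ([ κ≤k ] , _) = contradiction κ≤k (<⇒≱ k<κ)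
        above : ∀ {k l} → at k l ⊴ ([ κ ] , s) →
          ∃[ k′ ] ∃[ l′ ] (node k′ l′ ∈ X × at k l ⊴ at k′ l′)
        above (k≤κ , inj₁ l≤0) = κ , b , b∈ , k≤κ , inj₁ l≤0
        above (k≤κ , inj₂ (κ≤k , l≤s)) with s-cofinal l≤s
        ... | l′ , l≤l′ , kl′∈ = κ , l′ , kl′∈ , k≤κ , inj₂ (κ≤k , [ l≤l′ ])
      q = proj₁ upper
      ⊴q : ∀ {k l} → node k l ∈ X → at k l ⊴ q
      ⊴q = proj₁ (proj₂ upper)
      cofinal : ∀ {k l} → at k l ⊴ q → ∃[ k′ ] ∃[ l′ ] (node k′ l′ ∈ X × at k l ⊴ at k′ l′)
      cofinal = proj₂ (proj₂ upper)

    -- Stated for any logic whose set quantifier ranges over the paths of this comb, to cover MPL on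
    -- the full comb and MTL on the ray.
    module Game {L : Logic} (range : ∀ {X} → Range L Comb X ⇔ IsPath Comb X) where

      -- Witnesses are answered coordinate by coordinate, each answer using up one `grow` of the
      -- cost. Negation flips the matching and so exchanges the two combs.
      transfer : ∀ {i j m m′ M} {ρ ρ′ : Vec Word i} {χ χ′ : Vec WordSet j} φ →
        M 0 0 → M m m′ → Similar (cost φ) M →
        Pointwise (NodeMatch M) ρ ρ′ → Pointwise (SetMatch M) χ χ′ →
        Sat {L} (comb m) ρ χ φ → Sat (comb m′) ρ′ χ′ φ
      transfer {m = m} {m′} (P zero x) zeros marks S ν ξ (lift s) =
        lift (subst (λ w → zero Subset.∈ KripkeTree.label (comb m′) w)
          (sym (spine-transfer zeros S marks (Pointwise.lookup ν x) (label⁻ m s))) (label⁺ m′))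
      transfer (x ≤′ y) zeros marks S ν ξ (lift s) =
        lift (⊑-transfer zeros S (Pointwise.lookup ν x) (Pointwise.lookup ν y) s)
      transfer (x ∈′ X) zeros marks S ν ξ (lift s) =
        lift (∈-transfer zeros S (Pointwise.lookup ν x) (Pointwise.lookup ξ X) s)
      transfer {M = M} (¬′ φ) zeros marks S ν ξ ¬s s =
        ¬s (transfer {M = flip M} φ zeros marks (similar-flip S)
          (Pointwise.sym node-flip ν) (Pointwise.sym set-flip ξ) s)
      transfer (φ ∧′ ψ) zeros marks S ν ξ (s , t) =
        transfer φ zeros marks (similar-weaken (m≤m⊔n _ _) S) ν ξ s ,
        transfer ψ zeros marks (similar-weaken (m≤n⊔m (cost φ) _) S) ν ξ t
      transfer (∃₁ φ) zeros marks S ν ξ (_ , (k , l , a , refl) , s)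
        with extend⁺ zeros S [ k ]
      ... | M₁ , [ k′ ] , f₁ , S₁ , Supremum.[ kk′ ]
        with extend⁺ (f₁ zeros) S₁ [ l ]
      ...   | M₂ , [ l′ ] , f₂ , S₂ , Supremum.[ ll′ ] =
        node k′ l′ , (k′ , l′ , a′ , refl) ,
        transfer φ (f zeros) (f marks) S₂
          ((k , l , k′ , l′ , f₂ kk′ , ll′ , a , a′ , refl , refl) ∷ Pointwise.map (node-map f) ν)
          (Pointwise.map (set-map f) ξ) s
        where
        f  = λ {x} {y} z → f₂ {x} {y} (f₁ z)
        a′ = Allowed-transfer (f zeros) S₂ ll′ a
      transfer (∃₂ φ) zeros marks S ν ξ (X , r , s)
        with path-interval (Equivalence.to range r)
      ... | k , l , (κ , μ) , a , kl⊴q , D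
        with extend⁺ zeros S [ k ]
      ... | M₁ , [ k′ ] , f₁ , S₁ , Supremum.[ kk′ ]
        with extend⁺ (f₁ zeros) S₁ [ l ]
      ... | M₂ , [ l′ ] , f₂ , S₂ , Supremum.[ ll′ ]
        with extend⁺ (f₂ (f₁ zeros)) S₂ κ
      ... | M₃ , κ′ , f₃ , S₃ , κκ′
        with extend⁺ (f₃ (f₂ (f₁ zeros))) S₃ μ
      ... | M₄ , μ′ , f₄ , S₄ , μμ′ =
        Interval (at k′ l′) (κ′ , μ′) ,
        Equivalence.from range (interval-path
          (Allowed-transfer (f zeros) S₄ (f₄ (f₃ ll′)) a)
          (⊴-transfer (f zeros) S₄ pp′ qq′ kl⊴q)) ,
        transfer φ (f zeros) (f marks) S₄ (Pointwise.map (node-map f) ν)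
          (setMatch pp′ qq′ D (interval-described (at k′ l′) (κ′ , μ′))
            ∷ Pointwise.map (set-map f) ξ) s
        where
        f : _ ⇒ M₄
        f z = f₄ (f₃ (f₂ (f₁ z)))
        pp′ : PointMatch M₄ (at k l) (at k′ l′)
        pp′ = Supremum.[ f₄ (f₃ (f₂ kk′)) ] , Supremum.[ f₄ (f₃ ll′) ]
        qq′ : PointMatch M₄ (κ , μ) (κ′ , μ′)
        qq′ = ≈⁺-map f₄ κκ′ , μμ′

      far-marks-agree : ∀ (φ : Sentence L 1) {m m′} → cost φ < m → cost φ < m′ →
        comb m ⊨ φ → comb m′ ⊨ φ
      far-marks-agree φ d<m d<m′ = transfer φ (inj₁ (inj₂ (refl , refl))) (inj₂ (refl , refl))
        (marks-similar d<m d<m′) [] []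

-- Parity of the labelled node

childFormula : ∀ {L n i j} → Fin i → Fin i → Formula L n i j
childFormula x y = x ≤′ y ∧′ ¬′ y ≤′ x ∧′
  ¬′ ∃₁ (suc x ≤′ 0F ∧′ 0F ≤′ suc y ∧′ ¬′ 0F ≤′ suc x ∧′ ¬′ suc y ≤′ 0F)

module Child (em : ExcludedMiddle (lsuc 0ℓ)) {n : ℕ} (K : KripkeTree n) where
  open Classical em
  open KripkeTree K

  -- Covers (lookup ρ x) (lookup ρ y) is definitionally Sat K ρ χ (childFormula x y).
  Covers : Word → Word → Set₁
  Covers σ τ = σ ⊑₁ τ × ¬ τ ⊑₁ σ ×
    ¬ (∃[ υ ] (υ ∈ nodes × σ ⊑₁ υ × υ ⊑₁ τ × ¬ υ ⊑₁ σ × ¬ τ ⊑₁ υ))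
    where
    _⊑₁_ : Word → Word → Set₁
    σ ⊑₁ τ = Lift (lsuc 0ℓ) (σ ⊑ τ)

  -- The first letter from `σ` towards `τ` gives a node between them by convexity; as nothing lies
  -- strictly between, it is `τ`.
  child⁻ : ∀ σ τ → σ ∈ nodes → τ ∈ nodes → Covers σ τ → ∃[ a ] τ ≡ σ ∷ʳ a
  child⁻ σ τ σ∈ τ∈ (lift (u , eq) , τ⋢σ , ¬between) with u
  ... | [] = contradiction
      (lift ([] , sym (trans (++-identityʳ _) (trans eq (++-identityʳ _))))) τ⋢σ
  ... | a ∷ v = a , ⊑-antisym (stable λ τ⋢ → ¬between
      (σ ∷ʳ a , tree-convex isTree σ∈ τ∈ ⊑-∷ʳ σa⊑τ , lift ⊑-∷ʳ , lift σa⊑τ ,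
       ∷ʳ-⋢ σ ∘ lower , τ⋢ ∘ lower)) σa⊑τ
    where
    σa⊑τ : σ ∷ʳ a ⊑ τ
    σa⊑τ = v , trans eq (sym (∷ʳ-++ σ a v))

  child⁺ : ∀ σ a → Covers σ (σ ∷ʳ a)
  child⁺ σ a = lift ⊑-∷ʳ , ∷ʳ-⋢ σ ∘ lower ,
    λ { (_ , _ , lift σ⊑υ , lift υ⊑σa , υ⋢σ , σa⋢υ) →
      [ υ⋢σ ∘ lift , σa⋢υ ∘ lift ]′ (child-interval σ σ⊑υ υ⊑σa) }

Even : ℕ → Set
Even zero    = ⊤
Even (suc k) = ¬ Even k

-- `Q` says that the quantified set codes a node. The labelled node and the root are coded, and of a
-- node and its child up to the labelled node exactly one is; so coding there means even depth.
evenSentence : ∀ {L} → (∀ {i} → Fin i → Formula L 1 i 1) → Sentence L 1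
evenSentence Q = ∃₂ (∃₁ (P 0F 0F ∧′ Q 0F
  ∧′ ¬′ ∃₁ (¬′ ∃₁ (¬′ 1F ≤′ 0F) ∧′ ¬′ Q 0F)
  ∧′ ¬′ ∃₁ (∃₁ (childFormula 1F 0F ∧′ 0F ≤′ 2F ∧′ Q 1F ∧′ Q 0F))
  ∧′ ¬′ ∃₁ (∃₁ (childFormula 1F 0F ∧′ 0F ≤′ 2F ∧′ ¬′ Q 1F ∧′ ¬′ Q 0F))))

length-node : ∀ k l → length (node k l) ≡ k + l
length-node zero    l = length-replicate l
length-node (suc k) l = cong suc (length-node k l)

node-child : ∀ {k l k′ l′ a} → node k′ l′ ≡ node k l ∷ʳ a → k′ + l′ ≡ suc (k + l)
node-child {k} {l} {k′} {l′} {a} eq = trans (sym (length-node k′ l′)) (trans (cong length eq)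
  (trans (length-++ (node k l)) (trans (+-comm _ 1) (cong suc (length-node k l)))))

module Parity (em : ExcludedMiddle (lsuc 0ℓ)) (Teeth : Set) where
  open Classical em
  open Comb Teeth

  -- `G` is the meaning of the code `Q`, and `E` is a set whose coded spine nodes are those of even
  -- depth.
  module _ {L : Logic}
    (range⊆ : ∀ {X} → Range L Comb X → X ⊆ Comb)
    (Q : ∀ {i} → Fin i → Formula L 1 i 1)
    (G : WordSet → Word → Set)
    (Q⇔G : ∀ m {i} {ρ : Vec Word i} {X} x → X ⊆ Comb → lookup ρ x ∈ Comb →
      Sat (comb m) ρ (X ∷ []) (Q x) ⇔ G X (lookup ρ x))
    (E : WordSet)
    (E-range : Range L Comb E)
    (G⇔Even : ∀ k → G E (node k 0) ⇔ Even k)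
    where

    even-sound : ∀ m → comb m ⊨ evenSentence Q → Even m
    even-sound m (X , r , p , p∈ , lift ∈P , Qp , ¬root , ¬both , ¬neither)
      with refl ← label⁻ m {p} ∈P =
      proj₁ (alternates m ≤-refl) (Equivalence.to (Q⇔G m 0F (range⊆ r) p∈) Qp)
      where
      open Child em (comb m)
      toQ : ∀ {i} {ρ : Vec Word i} x → lookup ρ x ∈ Comb → G X (lookup ρ x) →
        Sat (comb m) ρ (X ∷ []) (Q x)
      toQ x x∈ = Equivalence.from (Q⇔G m x (range⊆ r) x∈)
      fromQ : ∀ {i} {ρ : Vec Word i} x → lookup ρ x ∈ Comb → Sat (comb m) ρ (X ∷ []) (Q x) →
        G X (lookup ρ x)
      fromQ x x∈ = Equivalence.to (Q⇔G m x (range⊆ r) x∈)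
      -- Induction along the spine: the root clause starts it and the two alternation clauses carry
      -- it to `m`.
      alternates : ∀ k → k ≤ m → (G X (node k 0) → Even k) × (Even k → G X (node k 0))
      alternates zero _ = (λ _ → tt) , λ _ → stable λ ¬g → ¬root
        ([] , on-spine 0 , (λ { (σ , _ , ⋢) → ⋢ (lift (σ , refl)) }) , ¬g ∘ fromQ 0F (on-spine 0))
      alternates (suc k) k<m =
        (λ g e → ¬both (node k 0 , on-spine k , node (suc k) 0 , on-spine (suc k) ,
          child , below , toQ 1F (on-spine k) (proj₂ ih e) , toQ 0F (on-spine (suc k)) g)) ,
        λ ¬e → stable λ ¬g → ¬neither (node k 0 , on-spine k , node (suc k) 0 , on-spine (suc k) ,
          child , below , ¬e ∘ proj₁ ih ∘ fromQ 1F (on-spine k) , ¬g ∘ fromQ 0F (on-spine (suc k)))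
        where
        ih = alternates k (<⇒≤ k<m)
        child : Covers (node k 0) (node (suc k) 0)
        child = subst (Covers (node k 0)) (node-∷ʳ-0 k) (child⁺ (node k 0) 0)
        below = lift (node-⊑⁺ ([ k<m ] , inj₁ [ z≤n ]))

    even-complete : ∀ m → Even m → comb m ⊨ evenSentence Q
    even-complete m e = E , E-range , node m 0 , on-spine m , lift (label⁺ m) ,
      toQ 0F (on-spine m) (Equivalence.from (G⇔Even m) e) ,
      (λ { (σ , σ∈ , ¬¬root , ¬q) → ¬q (toQ 0F σ∈ (subst (G E)
        (⊑-antisym {[]} (σ , refl) (stable λ ⋢ → ¬¬root ([] , on-spine 0 , ⋢ ∘ lower)))
        (Equivalence.from (G⇔Even 0) tt))) }) ,
      (λ { (σ , σ∈ , τ , τ∈ , child , lift τ⊑ , q , q′) →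
        let k , eq , eq′ = consecutive σ∈ τ∈ (child⁻ σ τ σ∈ τ∈ child) τ⊑ in
        Equivalence.to (G⇔Even (suc k)) (subst (G E) eq′ (fromQ 0F τ∈ q′))
          (Equivalence.to (G⇔Even k) (subst (G E) eq (fromQ 1F σ∈ q))) }) ,
      (λ { (σ , σ∈ , τ , τ∈ , child , lift τ⊑ , ¬q , ¬q′) →
        let k , eq , eq′ = consecutive σ∈ τ∈ (child⁻ σ τ σ∈ τ∈ child) τ⊑ in
        ¬q′ (toQ 0F τ∈ (subst (G E) (sym eq′) (Equivalence.from (G⇔Even (suc k)) λ ek →
          ¬q (toQ 1F σ∈ (subst (G E) (sym eq) (Equivalence.from (G⇔Even k) ek)))))) })
      where
      open Child em (comb m)
      toQ : ∀ {i} {ρ : Vec Word i} x → lookup ρ x ∈ Comb → G E (lookup ρ x) →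
        Sat (comb m) ρ (E ∷ []) (Q x)
      toQ x x∈ = Equivalence.from (Q⇔G m x (range⊆ E-range) x∈)
      fromQ : ∀ {i} {ρ : Vec Word i} x → lookup ρ x ∈ Comb → Sat (comb m) ρ (E ∷ []) (Q x) →
        G E (lookup ρ x)
      fromQ x x∈ = Equivalence.to (Q⇔G m x (range⊆ E-range) x∈)
      -- The alternation clauses concern only nodes below the labelled one, all on the spine, where
      -- `E` codes parity.
      on-spine-below : ∀ {σ} → σ ∈ Comb → σ ⊑ node m 0 → ∃[ k ] σ ≡ node k 0
      on-spine-below (k , l , _ , refl) σ⊑ with node-⊑⁻ k m σ⊑
      ... | _ , inj₁ [ z≤n ]       = k , refl
      ... | _ , inj₂ (_ , [ z≤n ]) = k , refl
      consecutive : ∀ {σ τ} → σ ∈ Comb → τ ∈ Comb → ∃[ a ] τ ≡ σ ∷ʳ a → τ ⊑ node m 0 →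
        ∃[ k ] (σ ≡ node k 0 × τ ≡ node (suc k) 0)
      consecutive σ∈ τ∈ (_ , refl) τ⊑
        with on-spine-below σ∈ (⊑-trans ⊑-∷ʳ τ⊑) | on-spine-below τ∈ τ⊑
      ... | k , refl | k′ , eq′ = k , refl , trans eq′ (cong (λ k → node k 0)
        (trans (sym (+-identityʳ k′)) (trans (node-child {k} {0} {k′} {0} (sym eq′))
          (cong suc (+-identityʳ k)))))

    -- Both `m` and `suc m` exceed the cost of `ψ`, which therefore cannot tell them apart, although
    -- exactly one is even.
    separation : ∀ {L′} → (∀ {X} → Range L′ Comb X ⇔ IsPath Comb X) →
      ∀ (C : Class) → (∀ m → comb m ∈ C) → ¬ (L ≼[ C ] L′)
    separation range C combs L≼L′ with L≼L′ 1 (evenSentence Q)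
    ... | ψ , equivalent = ¬even even
      where
      open Game em range
      m = suc (cost ψ)
      even⇒ : ∀ m → Even m → comb m ⊨ ψ
      even⇒ m = Equivalence.to (equivalent (comb m) (combs m)) ∘ even-complete m
      ⇒even : ∀ m → comb m ⊨ ψ → Even m
      ⇒even m = even-sound m ∘ Equivalence.from (equivalent (comb m) (combs m))
      ¬even : ¬ Even m
      ¬even e = ⇒even (suc m) (far-marks-agree ψ ≤-refl (m≤n⇒m≤1+n ≤-refl) (even⇒ m e)) e
      even : Even m
      even = ⇒even m (far-marks-agree ψ (m≤n⇒m≤1+n ≤-refl) ≤-refl (even⇒ (suc m) ¬even))

-- The bare ray, separating MSO from MTL

module Ray (em : ExcludedMiddle (lsuc 0ℓ)) where
  open Comb ⊥

  evenNodes : WordSet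
  evenNodes w = ∃[ k ] (Even k × w ≡ node k 0)

  ray-chain : Chain Comb
  ray-chain (k , _ , inj₁ z≤n , refl) (k′ , _ , inj₁ z≤n , refl) = Sum.map
    (λ k≤k′ → node-⊑⁺ {k} ([ k≤k′ ] , inj₁ [ z≤n ]))
    (λ k′≤k → node-⊑⁺ {k′} ([ k′≤k ] , inj₁ [ z≤n ])) (≤-total k k′)

  MSO⋠MTL : ∀ (C : Class) → (∀ m → comb m ∈ C) → ¬ (MSO ≼[ C ] MTL)
  MSO⋠MTL = Parity.separation em ⊥ {MSO} id (_∈′ 0F) (λ X σ → σ ∈ X)
    (λ _ _ _ _ → mk⇔ lower lift)
    evenNodes (λ { (k , _ , refl) → on-spine k })
    (λ k → mk⇔ (λ { (k′ , e , eq) → subst Even (sym (proj₁ (node-injective k k′ eq))) e })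
               (λ e → k , e , refl))
    (mk⇔ (λ s → chain⇒path s λ σ∈ τ∈ → ray-chain (proj₁ s σ∈) (proj₁ s τ∈)) proj₁)

-- The full comb, separating MTL from MPL

module FullComb (em : ExcludedMiddle (lsuc 0ℓ)) where
  open Comb ⊤

  -- A spine node is marked by its tooth, i.e. by having two children in X.
  branches : ∀ {i} → Fin i → Formula MTL 1 i 1
  branches x = ∃₁ (∃₁ (childFormula (suc (suc x)) 1F ∧′ childFormula (suc (suc x)) 0F
    ∧′ 1F ∈′ 0F ∧′ 0F ∈′ 0F ∧′ ¬′ 1F ≤′ 0F))

  Branches : WordSet → Word → Set
  Branches X σ = ∃[ a ] ∃[ b ] (σ ∷ʳ a ∈ X × σ ∷ʳ b ∈ X × ¬ a ≡ b)

  branches⇔ : ∀ m {i} {ρ : Vec Word i} {X} x → X ⊆ Comb → lookup ρ x ∈ Comb →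
    Sat (comb m) ρ (X ∷ []) (branches x) ⇔ Branches X (lookup ρ x)
  branches⇔ m {ρ = ρ} {X} x X⊆ x∈ = mk⇔ to from
    where
    open Child em (comb m)
    to : Sat (comb m) ρ (X ∷ []) (branches x) → Branches X (lookup ρ x)
    to (σ , σ∈ , τ , τ∈ , c , c′ , lift σ∈X , lift τ∈X , σ⋢τ)
      with child⁻ (lookup ρ x) σ x∈ σ∈ c | child⁻ (lookup ρ x) τ x∈ τ∈ c′
    ... | a , refl | b , refl = a , b , σ∈X , τ∈X , λ { refl → σ⋢τ (lift ⊑-refl) }
    from : Branches X (lookup ρ x) → Sat (comb m) ρ (X ∷ []) (branches x)
    from (a , b , a∈ , b∈ , a≢b) = _ , X⊆ a∈ , _ , X⊆ b∈ ,
      child⁺ (lookup ρ x) a , child⁺ (lookup ρ x) b ,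
      lift a∈ , lift b∈ , a≢b ∘ ∷ʳ-⊑-injective (lookup ρ x) ∘ lower

  -- The whole spine with the teeth of the even columns. The spine keeps the set a subtree and gives
  -- each spine node one child, so a second child marks even depth.
  evenTeeth : WordSet
  evenTeeth w = ∃[ k ] ∃[ l ] ((l ≤ 0 ⊎ Even k) × w ≡ node k l)

  evenTeeth⊆ : evenTeeth ⊆ Comb
  evenTeeth⊆ (k , l , _ , eq) = k , l , inj₂ tt , eq

  evenTeeth-rooted : IsRooted evenTeeth []
  evenTeeth-rooted = mkRooted (0 , 0 , inj₁ z≤n , refl) (λ _ → _ , refl) closed
    where
    closed : ∀ {σ τ} → σ ∈ evenTeeth → [] ⊑ τ → τ ⊑ σ → τ ∈ evenTeeth
    closed (k , l , e , refl) _ τ⊑σ with prefix-node k l τ⊑σ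
    ... | k′ , l′ , l′≤l , refl with node-⊑⁻ k′ k τ⊑σ
    ...   | _ , inj₁ [ l′≤0 ] = k′ , l′ , inj₁ l′≤0 , refl
    ...   | [ k′≤k ] , inj₂ ([ k≤k′ ] , _) with refl ← ≤-antisym k′≤k k≤k′ =
      k′ , l′ , Sum.map₁ (≤-trans l′≤l) e , refl

  branches-even : ∀ k → Branches evenTeeth (node k 0) ⇔ Even k
  branches-even k = mk⇔
    (λ { (_ , _ , a∈ , b∈ , a≢b) →
      [ (λ a≡0 → [ (λ b≡0 → contradiction (trans a≡0 (sym b≡0)) a≢b) , id ]′ (tooth b∈)) , id ]′
      (tooth a∈) })
    (λ e → 0 , 1 , (suc k , 0 , inj₁ z≤n , node-∷ʳ-0 k) , (k , 1 , inj₂ e , node-∷ʳ-1 k 0) , λ ())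
    where
    -- Comparing lengths, a child of height 0 is the next spine node, and any other child lies in
    -- column `k`, whose tooth must then be present.
    tooth : ∀ {a} → node k 0 ∷ʳ a ∈ evenTeeth → a ≡ 0 ⊎ Even k
    tooth {a} (k′ , l′ , v , eq)
      with node-child {k} {0} {k′} {l′} (sym eq) | node-⊑⁻ k k′ (subst (node k 0 ⊑_) eq ⊑-∷ʳ)
    tooth {a} (k′ , zero , v , eq) | sum | _
      with refl ← trans (sym (+-identityʳ k′)) (trans sum (cong suc (+-identityʳ k))) =
      inj₁ (∷ʳ-injectiveʳ (node k 0) (node k 0) (trans eq (sym (node-∷ʳ-0 k))))
    tooth {a} (k′ , suc l′ , inj₂ e , eq) | sum | [ k≤k′ ] , _ =
      inj₂ (subst Even (≤-antisym k′≤k k≤k′) e)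
      where
      k′≤k : k′ ≤ k
      k′≤k = ≤-trans (m≤m+n k′ l′)
        (≤-reflexive (trans (suc-injective (trans (sym (+-suc k′ l′)) sum)) (+-identityʳ k)))

  MTL⋠MPL : ∀ (C : Class) → (∀ m → comb m ∈ C) → ¬ (MTL ≼[ C ] MPL)
  MTL⋠MPL = Parity.separation em ⊤ {MTL} proj₁ branches Branches branches⇔
    evenTeeth (evenTeeth⊆ , rooted⇒tree evenTeeth-rooted) branches-even (mk⇔ id id)

corollary2 : ExcludedMiddle (lsuc 0ℓ) →
    (MPL ≺[ allKripkeTrees ] MTL × MTL ≺[ allKripkeTrees ] MSO) ×
    (MPL ≺[ finitelyBranchingKripkeTrees ] MTL × MTL ≺[ finitelyBranchingKripkeTrees ] MSO)
corollary2 em =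
  ((MPL≼MTL _ , MTL⋠MPL _ λ _ → _) , (MTL≼MSO _ , MSO⋠MTL _ λ _ → _)) ,
  ((MPL≼MTL _ , MTL⋠MPL _ λ _ {_} → Comb.comb-finitelyBranching ⊤) ,
   (MTL≼MSO _ , MSO⋠MTL _ λ _ {_} → Comb.comb-finitelyBranching ⊥))
  where
  open Classical em
  open FullComb em
  open Ray em
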